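{- Let $n$ and $r$ be integers with $1\le r\le n$, let $P_n=\left(\binom{i-1}{j-1}\right)_{1\le i,j\le n}$ be the $n\times n$ lower triangular Pascal matrix, and let $I_n$ be the identity matrix. Then the integer matrix $(P_n-I_n)^r$ is equivalent to the $n\times n$ diagonal matrix $$\mathrm{diag}\big(1^{\overline{r}},2^{\overline{r}},\ldots,(n-r)^{\overline{r}},0,\ldots,0\big),$$ whose last $r$ diagonal entries are $0$.
   Context: $i^{\overline{r}}=i(i+1)\cdots(i+r-1)$ is the rising factorial. Two $n\times n$ integer matrices $A,B$ are equivalent if there exist unimodular matrices $U,V$ (integer $n\times n$ matrices with determinant $\pm1$) such that $UAV=B$. A binomial coefficient $\binom{a}{b}$ with $0\le a<b$ is zero. -}

module Defs where

open import Algebra.Properties.Semiring.Sum using (sum)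
open import Data.Bool.Base using (if_then_else_)
open import Data.Fin.Base using (Fin; zero; suc; toℕ; punchIn)
import Data.Fin.Properties as Fin
open import Data.Integer.Base using (ℤ; +_; 0ℤ; 1ℤ; -1ℤ; _-_; _*_; _^_)
open import Data.Integer.Properties using (+-*-semiring)
open import Data.Nat.Base as ℕ using (ℕ; zero; suc; _∸_)
open import Data.Nat.Combinatorics using (_C_)
import Data.Nat.Properties as ℕ
open import Data.Product.Base using (_×_; ∃₂)
open import Data.Sum.Base using (_⊎_)
open import Data.Vec.Functional using (Vector; replicate)
open import Relation.Binary.PropositionalEquality.Core using (_≡_)
open import Relation.Nullary.Decidable.Core using (does)

infix  4 _≈ᴹ_ _∼_
infixl 6 _-ᴹ_
infixl 7 _*ᴹ_
infixr 8 _^ᴹ_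
infix  8 _rising_

Matrix : ℕ → Set
Matrix n = Fin n → Fin n → ℤ

-- Matrices are functions, so they are compared entrywise.
_≈ᴹ_ : ∀ {n} → Matrix n → Matrix n → Set
A ≈ᴹ B = ∀ i j → A i j ≡ B i j

diag : ∀ {n} → Vector ℤ n → Matrix n
diag d i j = if does (i Fin.≟ j) then d i else 0ℤ

I : ∀ n → Matrix n
I n = diag (replicate n 1ℤ)

_-ᴹ_ : ∀ {n} → Matrix n → Matrix n → Matrix n
(A -ᴹ B) i j = A i j - B i j

_*ᴹ_ : ∀ {n} → Matrix n → Matrix n → Matrix n
(A *ᴹ B) i j = sum +-*-semiring (λ k → A i k * B k j)

_^ᴹ_ : ∀ {n} → Matrix n → ℕ → Matrix n
A ^ᴹ zero  = I _
A ^ᴹ suc r = A *ᴹ (A ^ᴹ r)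

-- Laplace expansion along the first row; punchIn j skips column j.
det : ∀ {n} → Matrix n → ℤ
det {zero}  A = 1ℤ
det {suc n} A = sum +-*-semiring λ j →
  (-1ℤ ^ toℕ j) * A zero j * det (λ k l → A (suc k) (punchIn j l))

Unimodular : ∀ {n} → Matrix n → Set
Unimodular U = det U ≡ 1ℤ ⊎ det U ≡ -1ℤ

_∼_ : ∀ {n} → Matrix n → Matrix n → Set
A ∼ B = ∃₂ λ U V → Unimodular U × Unimodular V × U *ᴹ A *ᴹ V ≈ᴹ B

-- i rising r = i (i + 1) ⋯ (i + r - 1)
_rising_ : ℕ → ℕ → ℕ
i rising zero  = 1
i rising suc r = (i rising r) ℕ.* (i ℕ.+ r)

-- Indices in Fin n start at 0, so the 1-based entry binom(i-1, j-1) is i C j.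
Pascal : ∀ n → Matrix n
Pascal n i j = + (toℕ i C toℕ j)

-- (1 rising r, 2 rising r, …, (n - r) rising r, 0, …, 0); the k-th entry
-- counted from 1 sits at index k - 1. Intended for r ≤ n, where ∸ does not
-- truncate.
risingFactorials : ∀ n → ℕ → Vector ℤ n
risingFactorials n r i =
  if does (toℕ i ℕ.<? n ∸ r) then + (suc (toℕ i) rising r) else 0ℤ

{-# OPTIONS --safe #-}
-- On polynomials in x, P - I is the forward difference operator Δ written in
-- the monomial basis, and Δʳ sends the falling factorial x(x-1)⋯(x-(k+r)+1) to
-- (k+1) rising r times the falling factorial of degree k.  The change of basis
-- between powers and falling factorials is given by the two kinds of Stirling
-- numbers, hence is unitriangular over ℤ.  So row k + r of s (P - I)ʳ S is
-- (k+1) rising r times the k-th unit vector, where s and S are the Stirling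
-- matrices; it remains to move these rows to the top.  Since the first r rows
-- of (P - I)ʳ vanish, the left factor may be altered in its first r columns, and
-- r unit vectors selecting these zero rows complete it to a column rotation of a
-- unitriangular matrix.
module Submission where

open import Algebra.Properties.Semiring.Sum
open import Data.Bool.Base using (if_then_else_)
open import Data.Fin.Base as Fin using (Fin; zero; suc; toℕ; punchIn; splitAt; cast)
import Data.Fin.Properties as Fin
open import Data.Fin.Permutation as Perm using (Permutation′; _⟨$⟩ʳ_; _⟨$⟩ˡ_)
open import Data.Integer.Base using (ℤ; +_; 0ℤ; 1ℤ; -1ℤ; _+_; _-_; -_; _*_; _^_)
open import Data.Integer.Properties as ℤ using (+-*-semiring)
open import Data.Integer.Tactic.RingSolver using (solve-∀)
open import Data.Nat.Base as ℕ using (ℕ; zero; suc; pred; _≤_; _<_; z<s; s<s; s<s⁻¹)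
open import Data.Nat.Combinatorics using (_C_; nCn≡1; k>n⇒nCk≡0; nCk+nC[k+1]≡[n+1]C[k+1])
import Data.Nat.Properties as ℕ
open import Data.Product.Base using (_,_)
open import Data.Sum.Base using (_⊎_; inj₁; inj₂)
open import Data.Sum.Algebra using (⊎-comm)
open import Data.Vec.Functional using (Vector)
open import Function.Base using (_∘_; case_of_)
open import Function.Construct.Composition using (_↔-∘_)
open import Function.Construct.Symmetry using (↔-sym)
open import Relation.Binary.Definitions using (tri<; tri≈; tri>)
open import Relation.Binary.PropositionalEquality
open import Relation.Nullary.Decidable using (does; yes; no; dec-true; dec-false)
open import Relation.Nullary.Negation using (¬_; contradiction)

open import Defs

open ≡-Reasoning

-- Finite sums of integers.

private
  ∑ : ∀ {n} → Vector ℤ n → ℤ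
  ∑ = sum +-*-semiring

∑-zero : ∀ {n} {f : Vector ℤ n} → (∀ i → f i ≡ 0ℤ) → ∑ f ≡ 0ℤ
∑-zero {n} f≡0 = trans (sum-cong-≗ +-*-semiring f≡0) (sum-replicate-zero +-*-semiring n)

∑-single : ∀ {n} (f : Vector ℤ n) i → (∀ j → j ≢ i → f j ≡ 0ℤ) → ∑ f ≡ f i
∑-single {suc n} f i f≡0 = begin
  ∑ f                       ≡⟨ sum-remove +-*-semiring {i = i} f ⟩
  f i + ∑ (f ∘ punchIn i)   ≡⟨ cong (λ b → f i + b) (∑-zero λ j → f≡0 (punchIn i j) (Fin.punchInᵢ≢i i j)) ⟩
  f i + 0ℤ                  ≡⟨ ℤ.+-identityʳ (f i) ⟩
  f i                       ∎

-- Associativity of row times matrix times column, which lets a row of Stirling numbers absorb the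
-- leftmost factor of a power.
*-∑-assoc : ∀ {m n} (a : Vector ℤ m) (B : Fin m → Fin n → ℤ) (c : Vector ℤ n) →
  ∑ (λ j → a j * ∑ (λ k → B j k * c k)) ≡ ∑ (λ k → ∑ (λ j → a j * B j k) * c k)
*-∑-assoc {m} {n} a B c = begin
  ∑ (λ j → a j * ∑ (λ k → B j k * c k))
    ≡⟨ sum-cong-≗ +-*-semiring {m} (λ j → *-distribˡ-sum +-*-semiring (a j) (λ k → B j k * c k)) ⟩
  ∑ (λ j → ∑ (λ k → a j * (B j k * c k)))
    ≡⟨ ∑-comm +-*-semiring (λ j k → a j * (B j k * c k)) ⟩
  ∑ (λ k → ∑ (λ j → a j * (B j k * c k)))
    ≡⟨ sum-cong-≗ +-*-semiring {n} (λ k → sum-cong-≗ +-*-semiring {m} λ j →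
         sym (ℤ.*-assoc (a j) (B j k) (c k))) ⟩
  ∑ (λ k → ∑ (λ j → a j * B j k * c k))
    ≡⟨ sum-cong-≗ +-*-semiring {n} (λ k → sym (*-distribʳ-sum +-*-semiring (c k) (λ j → a j * B j k))) ⟩
  ∑ (λ k → ∑ (λ j → a j * B j k) * c k) ∎

∑-*-assoc : ∀ {n} c (a b : Vector ℤ n) → ∑ (λ j → c * a j * b j) ≡ c * ∑ (λ j → a j * b j)
∑-*-assoc {n} c a b = trans (sum-cong-≗ +-*-semiring {n} λ j → ℤ.*-assoc c (a j) (b j))
                            (sym (*-distribˡ-sum +-*-semiring c (λ j → a j * b j)))

-- Determinants of column-permuted unitriangular matrices.

-1^n≡±1 : ∀ n → (-1ℤ ^ n ≡ 1ℤ) ⊎ (-1ℤ ^ n ≡ -1ℤ)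
-1^n≡±1 zero = inj₁ refl
-1^n≡±1 (suc n) with -1^n≡±1 n
... | inj₁ eq = inj₂ (cong (-1ℤ *_) eq)
... | inj₂ eq = inj₁ (cong (-1ℤ *_) eq)

-- The Laplace expansion keeps only the term of column `π ⟨$⟩ʳ zero`, and the minor left there has
-- the same shape for `Perm.remove zero π`. Each expansion contributes a sign, so the sign of `π`
-- need not be computed.
unimodular-permuted-triangular : ∀ {n} (A : Matrix n) (π : Permutation′ n) →
  (∀ i → A i (π ⟨$⟩ʳ i) ≡ 1ℤ) → (∀ i k → i Fin.< k → A i (π ⟨$⟩ʳ k) ≡ 0ℤ) → Unimodular A
unimodular-permuted-triangular {zero} A π unit upper = inj₁ refl
unimodular-permuted-triangular {suc n} A π unit upper = signed (-1^n≡±1 (toℕ p)) minor-unimodular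
  where
  p : Fin (suc n)
  p = π ⟨$⟩ʳ zero

  minor : Fin (suc n) → Matrix n
  minor j k l = A (suc k) (punchIn j l)

  column : ∀ l → punchIn p (Perm.remove zero π ⟨$⟩ʳ l) ≡ π ⟨$⟩ʳ suc l
  column l = sym (Perm.punchIn-permute π zero l)

  minor-unimodular : Unimodular (minor p)
  minor-unimodular = unimodular-permuted-triangular (minor p) (Perm.remove zero π)
    (λ i → trans (cong (A (suc i)) (column i)) (unit (suc i)))
    (λ i k i<k → trans (cong (A (suc i)) (column k)) (upper (suc i) (suc k) (s<s i<k)))

  first-row : ∀ j → j ≢ p → A zero j ≡ 0ℤ
  -- A column other than `p` is the image of some `suc k`, so its entry in row `zero` lies above the
  -- permuted diagonal.
  first-row j j≢p with π ⟨$⟩ˡ j in eq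
  ... | zero  = contradiction (trans (sym (Perm.inverseʳ π)) (cong (π ⟨$⟩ʳ_) eq)) j≢p
  ... | suc k = trans (cong (A zero) (trans (sym (Perm.inverseʳ π)) (cong (π ⟨$⟩ʳ_) eq)))
                      (upper zero (suc k) z<s)

  det-expand : det A ≡ -1ℤ ^ toℕ p * det (minor p)
  det-expand = begin
    det A
      ≡⟨ ∑-single (λ j → -1ℤ ^ toℕ j * A zero j * det (minor j)) p (λ j j≢p → begin
           -1ℤ ^ toℕ j * A zero j * det (minor j)
             ≡⟨ cong (λ a → -1ℤ ^ toℕ j * a * det (minor j)) (first-row j j≢p) ⟩
           -1ℤ ^ toℕ j * 0ℤ * det (minor j)
             ≡⟨ cong (_* det (minor j)) (ℤ.*-zeroʳ (-1ℤ ^ toℕ j)) ⟩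
           0ℤ ∎) ⟩
    -1ℤ ^ toℕ p * A zero p * det (minor p)
      ≡⟨ cong (λ a → -1ℤ ^ toℕ p * a * det (minor p)) (unit zero) ⟩
    -1ℤ ^ toℕ p * 1ℤ * det (minor p)
      ≡⟨ cong (_* det (minor p)) (ℤ.*-identityʳ (-1ℤ ^ toℕ p)) ⟩
    -1ℤ ^ toℕ p * det (minor p) ∎

  signed : (-1ℤ ^ toℕ p ≡ 1ℤ) ⊎ (-1ℤ ^ toℕ p ≡ -1ℤ) → Unimodular (minor p) → Unimodular A
  signed (inj₁ s) (inj₁ d) = inj₁ (trans det-expand (cong₂ _*_ s d))
  signed (inj₁ s) (inj₂ d) = inj₂ (trans det-expand (cong₂ _*_ s d))
  signed (inj₂ s) (inj₁ d) = inj₂ (trans det-expand (cong₂ _*_ s d))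
  signed (inj₂ s) (inj₂ d) = inj₁ (trans det-expand (cong₂ _*_ s d))

-- Kronecker delta and Stirling numbers.

-- Multiplication by x on coefficient sequences of polynomials.
shift : (ℕ → ℤ) → ℕ → ℤ
shift f zero    = 0ℤ
shift f (suc l) = f l

δ₀ : ℕ → ℤ
δ₀ zero    = 1ℤ
δ₀ (suc _) = 0ℤ

-- The Kronecker delta, built from `shift` so that it obeys a recurrence of the same form as the
-- Stirling numbers and the binomials.
δ : ℕ → ℕ → ℤ
δ zero    = δ₀
δ (suc k) = shift (δ k)

-- Signed Stirling numbers of the first kind.
stirling₁ : ℕ → ℕ → ℤ
stirling₁ zero    l = δ₀ l
stirling₁ (suc k) l = shift (stirling₁ k) l - + k * stirling₁ k l

-- Row `j` holds the coordinates of x^j in the basis of falling factorials (x)ₗ; the recurrence is x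
-- (x)ₗ = (x)ₗ₊₁ + l (x)ₗ.
stirling₂ : ℕ → ℕ → ℤ
stirling₂ zero    l = δ₀ l
stirling₂ (suc j) l = shift (stirling₂ j) l + + l * stirling₂ j l

I≡δ : ∀ {n} (i j : Fin n) → I n i j ≡ δ (toℕ i) (toℕ j)
I≡δ zero    zero    = refl
I≡δ zero    (suc j) = refl
I≡δ (suc i) zero    = refl
I≡δ (suc i) (suc j) = I≡δ i j

diag≡*δ : ∀ {n} (d : Vector ℤ n) i j → diag d i j ≡ d i * δ (toℕ i) (toℕ j)
diag≡*δ d i j = trans scale (cong (d i *_) (I≡δ i j))
  where
  scale : diag d i j ≡ d i * I _ i j
  scale with i Fin.≟ j
  ... | yes _ = sym (ℤ.*-identityʳ (d i))
  ... | no  _ = sym (ℤ.*-zeroʳ (d i))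

δ-diagonal : ∀ k → δ k k ≡ 1ℤ
δ-diagonal zero    = refl
δ-diagonal (suc k) = δ-diagonal k

δ-upper : ∀ k l → k < l → δ k l ≡ 0ℤ
δ-upper zero    (suc l) _   = refl
δ-upper (suc k) (suc l) k<l = δ-upper k l (s<s⁻¹ k<l)

δ-lower : ∀ k l → l < k → δ k l ≡ 0ℤ
δ-lower (suc k) zero    _   = refl
δ-lower (suc k) (suc l) l<k = δ-lower k l (s<s⁻¹ l<k)

δ-weight : ∀ k l → (+ l - + k) * δ k l ≡ 0ℤ
δ-weight k l with ℕ.<-cmp k l
... | tri< k<l _ _ = trans (cong ((+ l - + k) *_) (δ-upper k l k<l)) (ℤ.*-zeroʳ (+ l - + k))
... | tri≈ _ refl _ = cong (_* δ k k) (ℤ.+-inverseʳ (+ k))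
... | tri> _ _ l<k = trans (cong ((+ l - + k) *_) (δ-lower k l l<k)) (ℤ.*-zeroʳ (+ l - + k))

a-m*0≡a : ∀ a m → a - m * 0ℤ ≡ a
a-m*0≡a = solve-∀

stirling₁-upper : ∀ k l → k < l → stirling₁ k l ≡ 0ℤ
stirling₁-upper zero    (suc l) _   = refl
stirling₁-upper (suc k) (suc l) k<l = begin
  stirling₁ k l - + k * stirling₁ k (suc l)
    ≡⟨ cong₂ (λ a b → a - + k * b) (stirling₁-upper k l (s<s⁻¹ k<l))
         (stirling₁-upper k (suc l) (ℕ.<-trans (ℕ.n<1+n k) k<l)) ⟩
  0ℤ - + k * 0ℤ ≡⟨ a-m*0≡a 0ℤ (+ k) ⟩
  0ℤ ∎

stirling₁-diagonal : ∀ k → stirling₁ k k ≡ 1ℤ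
stirling₁-diagonal zero    = refl
stirling₁-diagonal (suc k) = begin
  stirling₁ k k - + k * stirling₁ k (suc k)
    ≡⟨ cong₂ (λ a b → a - + k * b) (stirling₁-diagonal k) (stirling₁-upper k (suc k) (ℕ.n<1+n k)) ⟩
  1ℤ - + k * 0ℤ ≡⟨ a-m*0≡a 1ℤ (+ k) ⟩
  1ℤ ∎

stirling₂-upper : ∀ j l → j < l → stirling₂ j l ≡ 0ℤ
stirling₂-upper zero    (suc l) _   = refl
stirling₂-upper (suc j) (suc l) j<l = begin
  stirling₂ j l + + suc l * stirling₂ j (suc l)
    ≡⟨ cong₂ (λ a b → a + + suc l * b) (stirling₂-upper j l (s<s⁻¹ j<l))
         (stirling₂-upper j (suc l) (ℕ.<-trans (ℕ.n<1+n j) j<l)) ⟩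
  0ℤ + + suc l * 0ℤ ≡⟨ cong (λ a → 0ℤ + a) (ℤ.*-zeroʳ (+ suc l)) ⟩
  0ℤ ∎

stirling₂-diagonal : ∀ j → stirling₂ j j ≡ 1ℤ
stirling₂-diagonal zero    = refl
stirling₂-diagonal (suc j) = begin
  stirling₂ j j + + suc j * stirling₂ j (suc j)
    ≡⟨ cong₂ (λ a b → a + + suc j * b) (stirling₂-diagonal j) (stirling₂-upper j (suc j) (ℕ.n<1+n j)) ⟩
  1ℤ + + suc j * 0ℤ ≡⟨ cong (λ a → 1ℤ + a) (ℤ.*-zeroʳ (+ suc j)) ⟩
  1ℤ ∎

-- Falling factorials as linear functionals on sequences.

binomial-suc : ∀ j l → + (suc j C l) ≡ shift (λ l → + (j C l)) l + 1ℤ * + (j C l)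
binomial-suc j zero    = refl
binomial-suc j (suc l) = begin
  + (suc j C suc l)                    ≡⟨ cong (λ c → + c) (nCk+nC[k+1]≡[n+1]C[k+1] j l) ⟨
  + (j C l) + + (j C suc l)            ≡⟨ cong (λ b → + (j C l) + b) (ℤ.*-identityˡ (+ (j C suc l))) ⟨
  + (j C l) + 1ℤ * + (j C suc l)       ∎

-- The image of x (x - 1) ⋯ (x - k + 1) under the linear map x ^ j ↦ g j.
falling : ℕ → (ℕ → ℤ) → ℤ
falling zero    g = g 0
falling (suc k) g = falling k (g ∘ suc) - + k * falling k g

falling-cong : ∀ k {f g} → (∀ j → f j ≡ g j) → falling k f ≡ falling k g
falling-cong zero    f≗g = f≗g 0
falling-cong (suc k) f≗g =
  cong₂ (λ a b → a - + k * b) (falling-cong k (f≗g ∘ suc)) (falling-cong k f≗g)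

falling-linear : ∀ k f c g → falling k (λ j → f j + c * g j) ≡ falling k f + c * falling k g
falling-linear zero    f c g = refl
falling-linear (suc k) f c g = begin
  falling k (λ j → f (suc j) + c * g (suc j)) - + k * falling k (λ j → f j + c * g j)
    ≡⟨ cong₂ (λ a b → a - + k * b) (falling-linear k (f ∘ suc) c (g ∘ suc)) (falling-linear k f c g) ⟩
  (falling k (f ∘ suc) + c * falling k (g ∘ suc)) - + k * (falling k f + c * falling k g)
    ≡⟨ rearrange (falling k (f ∘ suc)) (falling k (g ∘ suc)) (falling k f) (falling k g) (+ k) c ⟩
  falling (suc k) f + c * falling (suc k) g ∎
  where
  rearrange : ∀ x y z w m c → (x + c * y) - m * (z + c * w) ≡ (x - m * z) + c * (y - m * w)
  rearrange = solve-∀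

falling-zero : ∀ k → falling k (λ _ → 0ℤ) ≡ 0ℤ
falling-zero zero    = refl
falling-zero (suc k) = begin
  falling k (λ _ → 0ℤ) - + k * falling k (λ _ → 0ℤ) ≡⟨ cong (λ a → a - + k * a) (falling-zero k) ⟩
  0ℤ - + k * 0ℤ                                     ≡⟨ a-m*0≡a 0ℤ (+ k) ⟩
  0ℤ                                                ∎

falling-shift : ∀ k (T : ℕ → ℕ → ℤ) l →
  falling k (λ j → shift (T j) l) ≡ shift (λ l → falling k (λ j → T j l)) l
falling-shift k T zero    = falling-zero k
falling-shift k T (suc l) = refl

-- If multiplication by x acts on column `l` as a shift plus the scalar `a`, the new factor x - k
-- acts as a shift plus `a - k`. The inductions for `δ`, `stirling₂` and the binomials all use this
-- step, with `a` equal to 0, `l` and 1.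
falling-recurrence : ∀ k (T : ℕ → ℕ → ℤ) a l →
  (∀ j → T (suc j) l ≡ shift (T j) l + a * T j l) →
  falling (suc k) (λ j → T j l) ≡
    shift (λ l → falling k (λ j → T j l)) l + (a - + k) * falling k (λ j → T j l)
falling-recurrence k T a l rec = begin
  falling k (λ j → T (suc j) l) - + k * F
    ≡⟨ cong (_- + k * F) (falling-cong k rec) ⟩
  falling k (λ j → shift (T j) l + a * T j l) - + k * F
    ≡⟨ cong (_- + k * F) (falling-linear k (λ j → shift (T j) l) a (λ j → T j l)) ⟩
  falling k (λ j → shift (T j) l) + a * F - + k * F
    ≡⟨ cong (λ b → b + a * F - + k * F) (falling-shift k T l) ⟩
  G + a * F - + k * F
    ≡⟨ collect G F a (+ k) ⟩
  G + (a - + k) * F ∎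
  where
  F = falling k (λ j → T j l)
  G = shift (λ l → falling k (λ j → T j l)) l
  collect : ∀ g f a m → g + a * f - m * f ≡ g + (a - m) * f
  collect = solve-∀

shift-cong : ∀ {f g} → (∀ l → f l ≡ g l) → ∀ l → shift f l ≡ shift g l
shift-cong f≗g zero    = refl
shift-cong f≗g (suc l) = f≗g l

-- The functional x^j ↦ `δ j l` extracts the coefficient of x^l.
falling-δ : ∀ k l → falling k (λ j → δ j l) ≡ stirling₁ k l
falling-δ zero    l = refl
falling-δ (suc k) l = begin
  falling (suc k) (λ j → δ j l)
    ≡⟨ falling-recurrence k δ 0ℤ l (λ j → sym (ℤ.+-identityʳ (shift (δ j) l))) ⟩
  shift (λ l → falling k (λ j → δ j l)) l + (0ℤ - + k) * falling k (λ j → δ j l)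
    ≡⟨ cong₂ (λ a b → a + (0ℤ - + k) * b) (shift-cong (falling-δ k) l) (falling-δ k l) ⟩
  shift (stirling₁ k) l + (0ℤ - + k) * stirling₁ k l
    ≡⟨ rearrange (shift (stirling₁ k) l) (+ k) (stirling₁ k l) ⟩
  stirling₁ (suc k) l ∎
  where
  rearrange : ∀ a m b → a + (0ℤ - m) * b ≡ a - m * b
  rearrange = solve-∀

-- Re-expanding a falling factorial in the falling basis returns a basis vector; this is the
-- inversion of the two Stirling matrices. The extra term of the recurrence dies because its weight
-- `l - k` is zero exactly where `δ k l` is not.
falling-stirling₂ : ∀ k l → falling k (λ j → stirling₂ j l) ≡ δ k l
falling-stirling₂ zero    l = refl
falling-stirling₂ (suc k) l = begin
  falling (suc k) (λ j → stirling₂ j l)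
    ≡⟨ falling-recurrence k stirling₂ (+ l) l (λ _ → refl) ⟩
  shift (λ l → falling k (λ j → stirling₂ j l)) l + (+ l - + k) * falling k (λ j → stirling₂ j l)
    ≡⟨ cong₂ (λ a b → a + (+ l - + k) * b) (shift-cong (falling-stirling₂ k) l) (falling-stirling₂ k l) ⟩
  shift (δ k) l + (+ l - + k) * δ k l
    ≡⟨ cong (λ b → shift (δ k) l + b) (δ-weight k l) ⟩
  shift (δ k) l + 0ℤ
    ≡⟨ ℤ.+-identityʳ _ ⟩
  δ (suc k) l ∎

-- The identity (x + 1)ₖ = (x)ₖ + k (x)ₖ₋₁ for falling factorials, in coordinates.
falling-binomial : ∀ k l → falling k (λ j → + (j C l)) ≡ stirling₁ k l + + k * stirling₁ (pred k) l
falling-binomial zero    zero    = refl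
falling-binomial zero    (suc l) = refl
falling-binomial (suc k) l = begin
  falling (suc k) (λ j → + (j C l))
    ≡⟨ falling-recurrence k (λ j l → + (j C l)) 1ℤ l (λ j → binomial-suc j l) ⟩
  shift (λ l → falling k (λ j → + (j C l))) l + (1ℤ - + k) * falling k (λ j → + (j C l))
    ≡⟨ cong₂ (λ a b → a + (1ℤ - + k) * b) (shift-cong (falling-binomial k) l) (falling-binomial k l) ⟩
  shift (λ l → stirling₁ k l + + k * stirling₁ (pred k) l) l
    + (1ℤ - + k) * (stirling₁ k l + + k * stirling₁ (pred k) l)
    ≡⟨ cong (_+ (1ℤ - + k) * (stirling₁ k l + + k * stirling₁ (pred k) l)) (shift-linear l) ⟩
  shift (stirling₁ k) l + + k * shift (stirling₁ (pred k)) l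
    + (1ℤ - + k) * (stirling₁ k l + + k * stirling₁ (pred k) l)
    ≡⟨ recombine k ⟩
  stirling₁ (suc k) l + + suc k * stirling₁ k l ∎
  where
  shift-linear : ∀ l → shift (λ l → stirling₁ k l + + k * stirling₁ (pred k) l) l ≡
                       shift (stirling₁ k) l + + k * shift (stirling₁ (pred k)) l
  shift-linear zero    = sym (trans (ℤ.+-identityˡ (+ k * 0ℤ)) (ℤ.*-zeroʳ (+ k)))
  shift-linear (suc l) = refl

  ring₀ : ∀ a b c d → a + 0ℤ * b + (1ℤ - 0ℤ) * (c + 0ℤ * d) ≡ (a - 0ℤ * c) + 1ℤ * c
  ring₀ = solve-∀

  ring₊ : ∀ m x y z → x + (1ℤ + m) * y + (1ℤ - (1ℤ + m)) * ((y - m * z) + (1ℤ + m) * z)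
    ≡ (x - (1ℤ + m) * (y - m * z)) + (1ℤ + (1ℤ + m)) * (y - m * z)
  ring₊ = solve-∀

  recombine : ∀ k →
    shift (stirling₁ k) l + + k * shift (stirling₁ (pred k)) l
      + (1ℤ - + k) * (stirling₁ k l + + k * stirling₁ (pred k) l)
    ≡ stirling₁ (suc k) l + + suc k * stirling₁ k l
  -- At `zero` the `pred` terms carry the factor 0; at `suc k`, unfolding `stirling₁ (suc k) l` once
  -- leaves a ring identity.
  recombine zero    = ring₀ (shift δ₀ l) (shift δ₀ l) (δ₀ l) (δ₀ l)
  recombine (suc k) = ring₊ (+ k) (shift (stirling₁ (suc k)) l) (shift (stirling₁ k) l) (stirling₁ k l)

-- Links matrix products to `falling`: row `k` is supported on columns up to `k`, so cutting the sum
-- at `n > k` loses nothing.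
∑-stirling₁ : ∀ {n} k (g : ℕ → ℤ) → k < n →
  ∑ {n} (λ j → stirling₁ k (toℕ j) * g (toℕ j)) ≡ falling k g
∑-stirling₁ {suc n} zero g _ = begin
  1ℤ * g 0 + ∑ {n} (λ j → 0ℤ * g (suc (toℕ j)))
    ≡⟨ cong₂ _+_ (ℤ.*-identityˡ (g 0)) (∑-zero {n} λ _ → refl) ⟩
  g 0 + 0ℤ ≡⟨ ℤ.+-identityʳ (g 0) ⟩
  g 0      ∎
∑-stirling₁ {suc n} (suc k) g k<n = begin
  ∑ {suc n} (λ j → stirling₁ (suc k) (toℕ j) * g (toℕ j))
    ≡⟨ sum-cong-≗ +-*-semiring {suc n} (λ j →
         distrib (shift (stirling₁ k) (toℕ j)) (+ k) (stirling₁ k (toℕ j)) (g (toℕ j))) ⟩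
  ∑ {suc n} (λ j → shift (stirling₁ k) (toℕ j) * g (toℕ j) + - + k * terms j)
    ≡⟨ ∑-distrib-+ +-*-semiring {suc n} (λ j → shift (stirling₁ k) (toℕ j) * g (toℕ j))
         (λ j → - + k * terms j) ⟩
  (0ℤ + ∑ {n} (λ j → stirling₁ k (toℕ j) * g (suc (toℕ j)))) + ∑ {suc n} (λ j → - + k * terms j)
    ≡⟨ cong₂ _+_ (trans (ℤ.+-identityˡ _) (∑-stirling₁ k (g ∘ suc) (s<s⁻¹ k<n)))
         (trans (sym (*-distribˡ-sum +-*-semiring (- + k) terms))
                (cong (- + k *_) (∑-stirling₁ k g (ℕ.<-trans (ℕ.n<1+n k) k<n)))) ⟩
  falling k (g ∘ suc) + - + k * falling k g
    ≡⟨ cong (λ b → falling k (g ∘ suc) + b) (sym (ℤ.neg-distribˡ-* (+ k) (falling k g))) ⟩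
  falling (suc k) g ∎
  where
  terms : Vector ℤ (suc n)
  terms j = stirling₁ k (toℕ j) * g (toℕ j)

  distrib : ∀ a m b c → (a - m * b) * c ≡ a * c + - m * (b * c)
  distrib = solve-∀

-- The difference matrix acting on Stirling rows.

Δ : ∀ n → Matrix n
Δ n = Pascal n -ᴹ I n

-- In coordinates, Δ (x)ₖ = k (x)ₖ₋₁. At `k = 0` the factor `k` makes the value of `pred`
-- immaterial.
stirling₁-Δ : ∀ {n} k (l : Fin n) → k < n →
  ∑ (λ j → stirling₁ k (toℕ j) * Δ n j l) ≡ + k * stirling₁ (pred k) (toℕ l)
stirling₁-Δ {n} k l k<n = begin
  ∑ (λ j → stirling₁ k (toℕ j) * Δ n j l)
    ≡⟨ sum-cong-≗ +-*-semiring (λ j → cong (stirling₁ k (toℕ j) *_) (Δ-entry j)) ⟩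
  ∑ {n} (λ j → stirling₁ k (toℕ j) * (+ (toℕ j C toℕ l) + -1ℤ * δ (toℕ j) (toℕ l)))
    ≡⟨ ∑-stirling₁ k (λ j → + (j C toℕ l) + -1ℤ * δ j (toℕ l)) k<n ⟩
  falling k (λ j → + (j C toℕ l) + -1ℤ * δ j (toℕ l))
    ≡⟨ falling-linear k (λ j → + (j C toℕ l)) -1ℤ (λ j → δ j (toℕ l)) ⟩
  falling k (λ j → + (j C toℕ l)) + -1ℤ * falling k (λ j → δ j (toℕ l))
    ≡⟨ cong₂ (λ a b → a + -1ℤ * b) (falling-binomial k (toℕ l)) (falling-δ k (toℕ l)) ⟩
  stirling₁ k (toℕ l) + + k * stirling₁ (pred k) (toℕ l) + -1ℤ * stirling₁ k (toℕ l)
    ≡⟨ cancel (stirling₁ k (toℕ l)) (+ k * stirling₁ (pred k) (toℕ l)) ⟩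
  + k * stirling₁ (pred k) (toℕ l) ∎
  where
  Δ-entry : ∀ j → Δ n j l ≡ + (toℕ j C toℕ l) + -1ℤ * δ (toℕ j) (toℕ l)
  Δ-entry j = cong (λ b → + (toℕ j C toℕ l) + b)
    (trans (cong -_ (I≡δ j l)) (sym (ℤ.-1*i≡-i (δ (toℕ j) (toℕ l)))))

  cancel : ∀ a b → a + b + -1ℤ * a ≡ b
  cancel = solve-∀

-- Each leftmost `Δ n` lowers the degree of the falling factorial by one and yields the old degree
-- as a factor. The first such factor is the last one in the rising factorial.
stirling₁-Δ^ : ∀ {n} r k (l : Fin n) → k ℕ.+ r < n →
  ∑ (λ j → stirling₁ (k ℕ.+ r) (toℕ j) * (Δ n ^ᴹ r) j l) ≡ + (suc k rising r) * stirling₁ k (toℕ l)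
stirling₁-Δ^ {n} zero k l k<n rewrite ℕ.+-identityʳ k = begin
  ∑ (λ j → stirling₁ k (toℕ j) * I n j l)
    ≡⟨ sum-cong-≗ +-*-semiring (λ j → cong (stirling₁ k (toℕ j) *_) (I≡δ j l)) ⟩
  ∑ {n} (λ j → stirling₁ k (toℕ j) * δ (toℕ j) (toℕ l))
    ≡⟨ ∑-stirling₁ k (λ j → δ j (toℕ l)) k<n ⟩
  falling k (λ j → δ j (toℕ l))
    ≡⟨ falling-δ k (toℕ l) ⟩
  stirling₁ k (toℕ l)
    ≡⟨ ℤ.*-identityˡ _ ⟨
  1ℤ * stirling₁ k (toℕ l) ∎
stirling₁-Δ^ {n} (suc r) k l k+r<n rewrite ℕ.+-suc k r = begin
  ∑ (λ j → stirling₁ (suc (k ℕ.+ r)) (toℕ j) * ∑ (λ m → Δ n j m * (Δ n ^ᴹ r) m l))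
    ≡⟨ *-∑-assoc (λ j → stirling₁ (suc (k ℕ.+ r)) (toℕ j)) (Δ n) (λ m → (Δ n ^ᴹ r) m l) ⟩
  ∑ (λ m → ∑ (λ j → stirling₁ (suc (k ℕ.+ r)) (toℕ j) * Δ n j m) * (Δ n ^ᴹ r) m l)
    ≡⟨ sum-cong-≗ +-*-semiring (λ m → cong (_* (Δ n ^ᴹ r) m l) (stirling₁-Δ (suc (k ℕ.+ r)) m k+r<n)) ⟩
  ∑ (λ m → + suc (k ℕ.+ r) * stirling₁ (k ℕ.+ r) (toℕ m) * (Δ n ^ᴹ r) m l)
    ≡⟨ ∑-*-assoc (+ suc (k ℕ.+ r)) (λ m → stirling₁ (k ℕ.+ r) (toℕ m)) (λ m → (Δ n ^ᴹ r) m l) ⟩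
  + suc (k ℕ.+ r) * ∑ (λ m → stirling₁ (k ℕ.+ r) (toℕ m) * (Δ n ^ᴹ r) m l)
    ≡⟨ cong (+ suc (k ℕ.+ r) *_) (stirling₁-Δ^ r k l (ℕ.<-trans (ℕ.n<1+n _) k+r<n)) ⟩
  + suc (k ℕ.+ r) * (+ (suc k rising r) * stirling₁ k (toℕ l))
    ≡⟨ ℤ.*-assoc (+ suc (k ℕ.+ r)) (+ (suc k rising r)) _ ⟨
  + suc (k ℕ.+ r) * + (suc k rising r) * stirling₁ k (toℕ l)
    ≡⟨ cong (_* stirling₁ k (toℕ l)) (trans (ℤ.*-comm (+ suc (k ℕ.+ r)) (+ (suc k rising r)))
                                            (sym (ℤ.pos-* (suc k rising r) (suc (k ℕ.+ r))))) ⟩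
  + (suc k rising suc r) * stirling₁ k (toℕ l) ∎

-- Zero rows of the powers, and the rotation past them.

Δ-upper : ∀ {n} (i j : Fin n) → toℕ i ≤ toℕ j → Δ n i j ≡ 0ℤ
Δ-upper i j i≤j with ℕ.m≤n⇒m<n∨m≡n i≤j
... | inj₁ i<j = trans (cong (λ b → + (toℕ i C toℕ j) - b) (trans (I≡δ i j) (δ-upper _ _ i<j)))
                       (cong (λ c → + c - 0ℤ) (k>n⇒nCk≡0 i<j))
-- On the diagonal both matrices have the entry 1.
... | inj₂ i≡j with refl ← Fin.toℕ-injective i≡j =
  trans (cong (λ b → + (toℕ i C toℕ i) - b) (trans (I≡δ i i) (δ-diagonal (toℕ i))))
        (cong (λ c → + c - 1ℤ) (nCn≡1 (toℕ i)))

-- As `Δ n` is strictly lower triangular, row `i` of the product only combines earlier rows of the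
-- previous power, which vanish by induction.
Δ^-zero-rows : ∀ {n} r (i j : Fin n) → toℕ i < r → (Δ n ^ᴹ r) i j ≡ 0ℤ
Δ^-zero-rows {n} (suc r) i j i<1+r = ∑-zero vanish
  where
  vanish : ∀ k → Δ n i k * (Δ n ^ᴹ r) k j ≡ 0ℤ
  vanish k with toℕ k ℕ.<? toℕ i
  ... | yes k<i = trans (cong (Δ n i k *_) (Δ^-zero-rows r k j (ℕ.<-≤-trans k<i (ℕ.<⇒≤pred i<1+r))))
                        (ℤ.*-zeroʳ (Δ n i k))
  ... | no  k≮i = cong (_* (Δ n ^ᴹ r) k j) (Δ-upper i k (ℕ.≮⇒≥ k≮i))

-- k ↦ r + k for k < m, and m + k ↦ k for k < r.
rotation : ∀ m r → Permutation′ (m ℕ.+ r)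
rotation m r =
  Perm.cast-id (ℕ.+-comm r m) ↔-∘ (↔-sym Fin.+↔⊎ ↔-∘ (⊎-comm (Fin m) (Fin r) ↔-∘ Fin.+↔⊎))

-- A column of the left factor either meets one of the `r` zero rows of the power, or is an original
-- column moved by exactly `r`.
rotationˡ-cases : ∀ m r (j : Fin (m ℕ.+ r)) →
  toℕ j < r ⊎ toℕ (rotation m r ⟨$⟩ˡ j) ℕ.+ r ≡ toℕ j
rotationˡ-cases m r j with splitAt r (cast (sym (ℕ.+-comm r m)) j) in eq
... | inj₁ a = inj₁ (subst (_< r)
        (trans (sym (Fin.toℕ-↑ˡ a m)) (trans (cong toℕ (Fin.splitAt⁻¹-↑ˡ eq)) (Fin.toℕ-cast _ j)))
        (Fin.toℕ<n a))
... | inj₂ b = inj₂ (begin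
  toℕ (b Fin.↑ˡ r) ℕ.+ r    ≡⟨ cong (ℕ._+ r) (Fin.toℕ-↑ˡ b r) ⟩
  toℕ b ℕ.+ r               ≡⟨ ℕ.+-comm (toℕ b) r ⟩
  r ℕ.+ toℕ b               ≡⟨ Fin.toℕ-↑ʳ r b ⟨
  toℕ (r Fin.↑ʳ b)          ≡⟨ cong toℕ (Fin.splitAt⁻¹-↑ʳ eq) ⟩
  toℕ (cast _ j)            ≡⟨ Fin.toℕ-cast _ j ⟩
  toℕ j                     ∎)

-- The two unimodular factors.

if-< : ∀ {i m} {x y : ℤ} → i < m → (if does (i ℕ.<? m) then x else y) ≡ x
if-< {i} {m} {x} {y} i<m = cong (λ b → if b then x else y) (dec-true (i ℕ.<? m) i<m)

if-≮ : ∀ {i m} {x y : ℤ} → ¬ i < m → (if does (i ℕ.<? m) then x else y) ≡ y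
if-≮ {i} {m} {x} {y} i≮m = cong (λ b → if b then x else y) (dec-false (i ℕ.<? m) i≮m)

-- The left factor before its columns are rotated. Offsetting both Stirling indices by `r` puts the
-- ones on the diagonal; the rows from `m` on are the completing unit vectors.
leftFactor : ℕ → ℕ → ℕ → ℕ → ℤ
leftFactor m r i k = if does (i ℕ.<? m) then stirling₁ (i ℕ.+ r) (k ℕ.+ r) else δ i k

left : ∀ m r → Matrix (m ℕ.+ r)
left m r i j = leftFactor m r (toℕ i) (toℕ (rotation m r ⟨$⟩ˡ j))

right : ∀ n → Matrix n
right n j l = stirling₂ (toℕ j) (toℕ l)

left-unimodular : ∀ m r → Unimodular (left m r)
left-unimodular m r = unimodular-permuted-triangular (left m r) (rotation m r)
  (λ i → trans (column i i) (diagonal (toℕ i)))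
  (λ i k i<k → trans (column i k) (upper (toℕ i) (toℕ k) i<k))
  where
  column : ∀ i k → left m r i (rotation m r ⟨$⟩ʳ k) ≡ leftFactor m r (toℕ i) (toℕ k)
  column i k = cong (leftFactor m r (toℕ i) ∘ toℕ) (Perm.inverseˡ (rotation m r))

  diagonal : ∀ i → leftFactor m r i i ≡ 1ℤ
  diagonal i with i ℕ.<? m
  ... | yes i<m = trans (if-< i<m) (stirling₁-diagonal (i ℕ.+ r))
  ... | no  i≮m = trans (if-≮ i≮m) (δ-diagonal i)

  upper : ∀ i k → i < k → leftFactor m r i k ≡ 0ℤ
  upper i k i<k with i ℕ.<? m
  ... | yes i<m = trans (if-< i<m) (stirling₁-upper (i ℕ.+ r) (k ℕ.+ r) (ℕ.+-monoˡ-< r i<k))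
  ... | no  i≮m = trans (if-≮ i≮m) (δ-upper i k i<k)

right-unimodular : ∀ n → Unimodular (right n)
right-unimodular n = unimodular-permuted-triangular (right n) Perm.id
  (λ i → stirling₂-diagonal (toℕ i)) (λ i k → stirling₂-upper (toℕ i) (toℕ k))

left-Δ^ : ∀ m r (i l : Fin (m ℕ.+ r)) →
  (left m r *ᴹ Δ (m ℕ.+ r) ^ᴹ r) i l ≡ risingFactorials (m ℕ.+ r) r i * stirling₁ (toℕ i) (toℕ l)
-- The rewrite turns the cutoff in `risingFactorials` into `m`, the cutoff in `leftFactor`.
left-Δ^ m r i l rewrite ℕ.m+n∸n≡m m r = case (toℕ i ℕ.<? m) of λ
  { (yes i<m) → begin
      ∑ (λ j → left m r i j * A j l)
        ≡⟨ sum-cong-≗ +-*-semiring (λ j → cong (_* A j l) (if-< i<m)) ⟩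
      ∑ (λ j → stirling₁ (toℕ i ℕ.+ r) (π⁻¹ j ℕ.+ r) * A j l)
        ≡⟨ sum-cong-≗ +-*-semiring unrotate ⟩
      ∑ (λ j → stirling₁ (toℕ i ℕ.+ r) (toℕ j) * A j l)
        ≡⟨ stirling₁-Δ^ r (toℕ i) l (ℕ.+-monoˡ-< r i<m) ⟩
      + (suc (toℕ i) rising r) * stirling₁ (toℕ i) (toℕ l)
        ≡⟨ cong (_* stirling₁ (toℕ i) (toℕ l)) (if-< i<m) ⟨
      _ ∎
  ; (no i≮m) → trans
      (∑-zero λ j → trans (cong (_* A j l) (if-≮ i≮m)) (vanish i≮m j))
      (cong (_* stirling₁ (toℕ i) (toℕ l)) (sym (if-≮ i≮m)))
  }
  where
  A : Matrix (m ℕ.+ r)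
  A = Δ (m ℕ.+ r) ^ᴹ r

  π⁻¹ : Fin (m ℕ.+ r) → ℕ
  π⁻¹ j = toℕ (rotation m r ⟨$⟩ˡ j)

  unrotate : ∀ j → stirling₁ (toℕ i ℕ.+ r) (π⁻¹ j ℕ.+ r) * A j l ≡
                   stirling₁ (toℕ i ℕ.+ r) (toℕ j) * A j l
  unrotate j with rotationˡ-cases m r j
  ... | inj₂ eq  = cong (λ k → stirling₁ (toℕ i ℕ.+ r) k * A j l) eq
  -- The two Stirling coefficients may differ here, but both multiply an entry of a zero row.
  ... | inj₁ j<r rewrite Δ^-zero-rows r j l j<r =
    trans (ℤ.*-zeroʳ (stirling₁ (toℕ i ℕ.+ r) (π⁻¹ j ℕ.+ r)))
          (sym (ℤ.*-zeroʳ (stirling₁ (toℕ i ℕ.+ r) (toℕ j))))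

  vanish : ¬ toℕ i < m → ∀ j → δ (toℕ i) (π⁻¹ j) * A j l ≡ 0ℤ
  vanish i≮m j with rotationˡ-cases m r j
  ... | inj₁ j<r = trans (cong (δ (toℕ i) (π⁻¹ j) *_) (Δ^-zero-rows r j l j<r))
                         (ℤ.*-zeroʳ (δ (toℕ i) (π⁻¹ j)))
  -- Here `π⁻¹ j < m ≤ toℕ i`, so the unit vector has entry 0 in this column.
  ... | inj₂ eq  = cong (_* A j l) (δ-lower (toℕ i) (π⁻¹ j) (ℕ.<-≤-trans
    (ℕ.+-cancelʳ-< r (π⁻¹ j) m (subst (_< m ℕ.+ r) (sym eq) (Fin.toℕ<n j))) (ℕ.≮⇒≥ i≮m)))

-- The left factor turns the power into a diagonal matrix times the first Stirling matrix, which
-- `right` then cancels.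
Δ^∼diag : ∀ m r → Δ (m ℕ.+ r) ^ᴹ r ∼ diag (risingFactorials (m ℕ.+ r) r)
Δ^∼diag m r = left m r , right n , left-unimodular m r , right-unimodular n , entry
  where
  n = m ℕ.+ r
  d = risingFactorials n r

  entry : left m r *ᴹ Δ n ^ᴹ r *ᴹ right n ≈ᴹ diag d
  entry i l = begin
    ∑ (λ k → (left m r *ᴹ Δ n ^ᴹ r) i k * stirling₂ (toℕ k) (toℕ l))
      ≡⟨ sum-cong-≗ +-*-semiring {n} (λ k → cong (_* stirling₂ (toℕ k) (toℕ l)) (left-Δ^ m r i k)) ⟩
    ∑ {n} (λ k → d i * stirling₁ (toℕ i) (toℕ k) * stirling₂ (toℕ k) (toℕ l))
      ≡⟨ ∑-*-assoc {n} (d i) (λ k → stirling₁ (toℕ i) (toℕ k)) (λ k → stirling₂ (toℕ k) (toℕ l)) ⟩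
    d i * ∑ {n} (λ k → stirling₁ (toℕ i) (toℕ k) * stirling₂ (toℕ k) (toℕ l))
      ≡⟨ cong (d i *_) (∑-stirling₁ (toℕ i) (λ k → stirling₂ k (toℕ l)) (Fin.toℕ<n i)) ⟩
    d i * falling (toℕ i) (λ k → stirling₂ k (toℕ l))
      ≡⟨ cong (d i *_) (falling-stirling₂ (toℕ i) (toℕ l)) ⟩
    d i * δ (toℕ i) (toℕ l)
      ≡⟨ diag≡*δ d i l ⟨
    diag d i l ∎

theorem3 : ∀ (n r : ℕ) → 1 ≤ r → r ≤ n →
    (Pascal n -ᴹ I n) ^ᴹ r ∼ diag (risingFactorials n r)
theorem3 n r _ r≤n =
  subst (λ n → Δ n ^ᴹ r ∼ diag (risingFactorials n r)) (ℕ.m∸n+n≡m r≤n) (Δ^∼diag (n ℕ.∸ r) r)
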